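{- For all finite multisets $\Gamma,\Delta$ of S4 formulas and all S4 formulas $A,B$: if $\mathrm{G3s}\vdash \Gamma\supset\Delta,\Box A,\Box B$ and $\mathrm{G3s}\vdash\Gamma\supset\Delta,\Box(A\to B),\Box B$, then $\mathrm{G3s}\vdash\Gamma\supset\Delta,\Box B$.
   Context: S4 formulas: $A ::= \bot \mid P \mid A_0\to A_1 \mid \Box A$ ($P$ atomic). Sequents $\Gamma\supset\Delta$ use finite multisets; $\Box\Gamma:=\{\Box C\mid C\in\Gamma\}$. G3s rules: (Ax) $P,\Gamma\supset\Delta,P$ ($P$ atomic); $(\bot\supset)$ $\bot,\Gamma\supset\Delta$; $(\to\supset)$ from $\Gamma\supset\Delta,A$ and $B,\Gamma\supset\Delta$ infer $A\to B,\Gamma\supset\Delta$; $(\supset\to)$ from $A,\Gamma\supset\Delta,B$ infer $\Gamma\supset\Delta,A\to B$; $(\Box\supset)$ from $A,\Box A,\Gamma\supset\Delta$ infer $\Box A,\Gamma\supset\Delta$; $(\supset\Box)$ from $\Box\Gamma\supset A$ infer $\Gamma',\Box\Gamma\supset\Delta',\Box A$. -}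

module Defs where

open import Data.List.Base using (List; []; _∷_; [_]; _++_; map)
open import Data.List.Relation.Binary.Permutation.Propositional using (_↭_)

infix  9 □_
infixr 6 _⇒_
infix  3 G3s⊢_⊃_

-- The set of atomic formulas is an arbitrary parameter; ⊥ᶠ is not atomic.
data Formula (Atom : Set) : Set where
  ⊥ᶠ   : Formula Atom
  atom : Atom → Formula Atom
  _⇒_  : Formula Atom → Formula Atom → Formula Atom
  □_   : Formula Atom → Formula Atom

-- Finite multisets are lists considered up to permutation.
Multiset : Set → Set
Multiset Atom = List (Formula Atom)

private
  variable
    Atom       : Set
    P          : Atom
    A B        : Formula Atom
    Γ Γ′ Γ₀ Δ Δ′ : Multiset Atom

-- The conclusion of each rule is matched only up to permutation (both in the
-- antecedent and in the succedent), so that every rule is a rule on multisets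
-- and no separate exchange rule is needed.
data G3s⊢_⊃_ {Atom : Set} : Multiset Atom → Multiset Atom → Set where

  Ax : Γ ↭ atom P ∷ Γ′ → Δ ↭ atom P ∷ Δ′ →
       G3s⊢ Γ ⊃ Δ

  ⊥⊃ : Γ ↭ ⊥ᶠ ∷ Γ′ →
       G3s⊢ Γ ⊃ Δ

  ⇒⊃ : Γ ↭ A ⇒ B ∷ Γ′ →
       G3s⊢ Γ′ ⊃ A ∷ Δ →
       G3s⊢ B ∷ Γ′ ⊃ Δ →
       G3s⊢ Γ ⊃ Δ

  ⊃⇒ : Δ ↭ A ⇒ B ∷ Δ′ →
       G3s⊢ A ∷ Γ ⊃ B ∷ Δ′ →
       G3s⊢ Γ ⊃ Δ

  □⊃ : Γ ↭ □ A ∷ Γ′ →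
       G3s⊢ A ∷ □ A ∷ Γ′ ⊃ Δ →
       G3s⊢ Γ ⊃ Δ

  ⊃□ : Γ ↭ Γ′ ++ map □_ Γ₀ → Δ ↭ □ A ∷ Δ′ →
       G3s⊢ map □_ Γ₀ ⊃ [ A ] →
       G3s⊢ Γ ⊃ Δ

{-# OPTIONS --safe #-}

-- Distribution of □ over ⇒ follows by cutting against □ (A ⇒ B), □ A ⊃ □ B.
-- Cut is eliminated in a cumulative variant of G3s, whose rules keep their
-- principal formula and see contexts only through membership, so that
-- weakening and contraction are both instances of monotonicity under inclusion.
-- To return to G3s, one generalises from membership to realisation: A ⇒ B on
-- the left may also be realised by B on the left or A on the right, and on the
-- right by A on the left together with B on the right.  The premises of G3s
-- rules realise everything their conclusions do (for ⊃□, the boxed antecedents),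
-- which makes inversion and contraction for G3s itself unnecessary.
module Submission where

open import Defs
open import Data.List.Base using ([]; _∷_; [_]; _++_; map)
open import Data.List.Membership.Propositional using (_∈_)
open import Data.List.Membership.Propositional.Properties
  using (∈-map⁺; ∈-map⁻; ∈-++⁺ʳ; ∈-∃++)
open import Data.List.Relation.Unary.Any using (here; there)
open import Data.List.Relation.Binary.Permutation.Propositional
  using (_↭_; ↭-refl; ↭-trans; ↭-sym; prep)
open import Data.List.Relation.Binary.Permutation.Propositional.Properties
  using (∈-resp-↭; shift)
open import Data.List.Relation.Binary.Subset.Propositional using (_⊆_)
open import Data.List.Relation.Binary.Subset.Propositional.Properties
  using (∷⁺ʳ; ∈-∷⁺ʳ)
open import Data.Product.Base using (∃-syntax; _,_)
open import Function.Base using (_∘_; id)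
open import Relation.Binary.PropositionalEquality.Core using (refl)

infix 3 _⊢_

private
  variable
    Atom                    : Set
    P                       : Atom
    A B C X                 : Formula Atom
    Γ Γ₀ Γ₁ Γ₂ Δ Δ₀ Δ₁ Δ₂   : Multiset Atom

-- The boxed part of an antecedent.

unboxed : Multiset Atom → Multiset Atom
unboxed []            = []
unboxed (⊥ᶠ ∷ Γ)      = unboxed Γ
unboxed (atom _ ∷ Γ)  = unboxed Γ
unboxed (_ ⇒ _ ∷ Γ)   = unboxed Γ
unboxed (□ A ∷ Γ)     = A ∷ unboxed Γ

nonBoxed : Multiset Atom → Multiset Atom
nonBoxed []            = []
nonBoxed (⊥ᶠ ∷ Γ)      = ⊥ᶠ ∷ nonBoxed Γ
nonBoxed (atom P ∷ Γ)  = atom P ∷ nonBoxed Γ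
nonBoxed (A ⇒ B ∷ Γ)   = A ⇒ B ∷ nonBoxed Γ
nonBoxed (□ _ ∷ Γ)     = nonBoxed Γ

boxed : Multiset Atom → Multiset Atom
boxed Γ = map □_ (unboxed Γ)

boxed-split : (Γ : Multiset Atom) → Γ ↭ nonBoxed Γ ++ boxed Γ
boxed-split []           = ↭-refl
boxed-split (⊥ᶠ ∷ Γ)     = prep _ (boxed-split Γ)
boxed-split (atom _ ∷ Γ) = prep _ (boxed-split Γ)
boxed-split (_ ⇒ _ ∷ Γ)  = prep _ (boxed-split Γ)
boxed-split (□ A ∷ Γ)    =
  ↭-trans (prep _ (boxed-split Γ)) (↭-sym (shift (□ A) (nonBoxed Γ) (boxed Γ)))

∈-unboxed⁺ : □ A ∈ Γ → A ∈ unboxed Γ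
∈-unboxed⁺ {Γ = □ _ ∷ _}    (here refl) = here refl
∈-unboxed⁺ {Γ = ⊥ᶠ ∷ _}     (there i)   = ∈-unboxed⁺ i
∈-unboxed⁺ {Γ = atom _ ∷ _} (there i)   = ∈-unboxed⁺ i
∈-unboxed⁺ {Γ = _ ⇒ _ ∷ _}  (there i)   = ∈-unboxed⁺ i
∈-unboxed⁺ {Γ = □ _ ∷ _}    (there i)   = there (∈-unboxed⁺ i)

∈-boxed⁺ : □ A ∈ Γ → □ A ∈ boxed Γ
∈-boxed⁺ = ∈-map⁺ □_ ∘ ∈-unboxed⁺

boxed⊆ : boxed Γ ⊆ Γ
boxed⊆ {Γ = Γ} = ∈-resp-↭ (↭-sym (boxed-split Γ)) ∘ ∈-++⁺ʳ (nonBoxed Γ)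

-- This is why `□R` can fix its antecedent as `boxed Γ`: any boxed context chosen by `⊃□` weakens to
-- it.
map□⊆boxed : map □_ Γ₀ ⊆ Γ → map □_ Γ₀ ⊆ boxed Γ
map□⊆boxed γ i with ∈-map⁻ □_ i
... | _ , _ , refl = ∈-boxed⁺ (γ i)

boxed-mono : Γ₁ ⊆ Γ₂ → boxed Γ₁ ⊆ boxed Γ₂
boxed-mono γ = map□⊆boxed (γ ∘ boxed⊆)

-- The cumulative calculus.

data _⊢_ {Atom : Set} (Γ Δ : Multiset Atom) : Set where
  ax : atom P ∈ Γ → atom P ∈ Δ → Γ ⊢ Δ
  ⊥L : ⊥ᶠ ∈ Γ → Γ ⊢ Δ
  ⇒L : A ⇒ B ∈ Γ → Γ ⊢ A ∷ Δ → B ∷ Γ ⊢ Δ → Γ ⊢ Δ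
  ⇒R : A ⇒ B ∈ Δ → A ∷ Γ ⊢ B ∷ Δ → Γ ⊢ Δ
  □L : □ A ∈ Γ → A ∷ Γ ⊢ Δ → Γ ⊢ Δ
  □R : □ A ∈ Δ → boxed Γ ⊢ [ A ] → Γ ⊢ Δ

weaken : Γ₁ ⊆ Γ₂ → Δ₁ ⊆ Δ₂ → Γ₁ ⊢ Δ₁ → Γ₂ ⊢ Δ₂
weaken γ δ (ax i j)   = ax (γ i) (δ j)
weaken γ δ (⊥L i)     = ⊥L (γ i)
weaken γ δ (⇒L i d e) = ⇒L (γ i) (weaken γ (∷⁺ʳ _ δ) d) (weaken (∷⁺ʳ _ γ) δ e)
weaken γ δ (⇒R i d)   = ⇒R (δ i) (weaken (∷⁺ʳ _ γ) (∷⁺ʳ _ δ) d)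
weaken γ δ (□L i d)   = □L (γ i) (weaken (∷⁺ʳ _ γ) δ d)
weaken γ δ (□R i d)   = □R (δ i) (weaken (boxed-mono γ) id d)

identity : (A : Formula Atom) → A ∈ Γ → A ∈ Δ → Γ ⊢ Δ
identity ⊥ᶠ       i j = ⊥L i
identity (atom _) i j = ax i j
identity (A ⇒ B)  i j = ⇒R j
  (⇒L (there i) (identity A (here refl) (here refl))
                (identity B (here refl) (here refl)))
identity (□ A)    i j =
  □R j (□L (∈-boxed⁺ i) (identity A (here refl) (here refl)))

-- Cut elimination.

∷-under : Γ₁ ⊆ C ∷ Γ₂ → X ∷ Γ₁ ⊆ C ∷ X ∷ Γ₂
∷-under γ = ∈-∷⁺ʳ (there (here refl)) (∷⁺ʳ _ there ∘ γ)

-- The inclusions let every recursive call on a subderivation take it as it is,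
-- without weakening, so the recursion is structural in the cut formula and then
-- in the two derivations.
mutual
  cut : (C : Formula Atom) → Γ₁ ⊢ Δ₁ → Γ₂ ⊢ Δ₂ →
        Γ₁ ⊆ Γ → Δ₁ ⊆ C ∷ Δ → Γ₂ ⊆ C ∷ Γ → Δ₂ ⊆ Δ → Γ ⊢ Δ
  cut C (ax i j) d₂ γ₁ δ₁ γ₂ δ₂ with δ₁ j
  -- The cut formula is an atom already in `Γ`, so its copy in `d₂` is contracted into that one.
  ... | here refl = weaken (∈-∷⁺ʳ (γ₁ i) id ∘ γ₂) δ₂ d₂
  ... | there j′  = ax (γ₁ i) j′
  cut C (⊥L i) d₂ γ₁ δ₁ γ₂ δ₂ = ⊥L (γ₁ i)
  cut C (⇒L i d e) d₂ γ₁ δ₁ γ₂ δ₂ = ⇒L (γ₁ i)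
    (cut C d d₂ γ₁ (∷-under δ₁) γ₂ (there ∘ δ₂))
    (cut C e d₂ (∷⁺ʳ _ γ₁) δ₁ (∷⁺ʳ _ there ∘ γ₂) δ₂)
  -- The premise may still contain the cut formula, even when that is principal; it is first cut
  -- away, giving `d′`.
  cut C (⇒R i d) d₂ γ₁ δ₁ γ₂ δ₂ with δ₁ i
    | cut C d d₂ (∷⁺ʳ _ γ₁) (∷-under δ₁) (∷⁺ʳ _ there ∘ γ₂) (there ∘ δ₂)
  ... | here refl | d′ = cut⇒ _ _ d′ d₂ id id γ₂ δ₂
  ... | there i′  | d′ = ⇒R i′ d′
  cut C (□L i d) d₂ γ₁ δ₁ γ₂ δ₂ =
    □L (γ₁ i) (cut C d d₂ (∷⁺ʳ _ γ₁) δ₁ (∷⁺ʳ _ there ∘ γ₂) δ₂)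
  cut C (□R i d) d₂ γ₁ δ₁ γ₂ δ₂ with δ₁ i
  ... | here refl = cut□ _ _ d d₂ (γ₁ ∘ boxed⊆) γ₂ δ₂
  ... | there i′  = □R i′ (weaken (boxed-mono γ₁) id d)

  -- `r` comes from the premise of a final `⇒R` on the left and is carried up the right derivation
  -- to each `⇒L` on the cut formula.
  cut⇒ : (A B : Formula Atom) → A ∷ Γ₀ ⊢ B ∷ Δ₀ → Γ₂ ⊢ Δ₂ →
         Γ₀ ⊆ Γ → Δ₀ ⊆ Δ → Γ₂ ⊆ A ⇒ B ∷ Γ → Δ₂ ⊆ Δ → Γ ⊢ Δ
  cut⇒ A B r (ax i j) γ₀ δ₀ γ₂ δ₂ with γ₂ i
  ... | there i′ = ax i′ (δ₂ j)
  cut⇒ A B r (⊥L i) γ₀ δ₀ γ₂ δ₂ with γ₂ i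
  ... | there i′ = ⊥L i′
  cut⇒ A B r (⇒L i d e) γ₀ δ₀ γ₂ δ₂ with γ₂ i
    | cut⇒ A B r d γ₀ (there ∘ δ₀) γ₂ (∷⁺ʳ _ δ₂)
    | cut⇒ A B r e (there ∘ γ₀) δ₀ (∷-under γ₂) δ₂
  -- Neither `d′` nor the inner cut is a subderivation, but `A` and `B` are smaller than the cut
  -- formula.
  ... | here refl | d′ | e′ =
    cut B (cut A d′ r id (∷⁺ʳ _ there) (∷⁺ʳ _ γ₀) (∷⁺ʳ _ δ₀)) e′ id id id id
  ... | there i′  | d′ | e′ = ⇒L i′ d′ e′
  cut⇒ A B r (⇒R i d) γ₀ δ₀ γ₂ δ₂ =
    ⇒R (δ₂ i) (cut⇒ A B r d (there ∘ γ₀) (there ∘ δ₀) (∷-under γ₂) (∷⁺ʳ _ δ₂))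
  cut⇒ A B r (□L i d) γ₀ δ₀ γ₂ δ₂ with γ₂ i
  ... | there i′ = □L i′ (cut⇒ A B r d (there ∘ γ₀) δ₀ (∷-under γ₂) δ₂)
  -- `boxed (A ⇒ B ∷ Γ)` computes to `boxed Γ`, so the cut formula never reaches this premise.
  cut⇒ A B r (□R i d) γ₀ δ₀ γ₂ δ₂ = □R (δ₂ i) (weaken (boxed-mono γ₂) id d)

  -- The antecedent of `r` is entirely boxed, so it survives when `□R` discards the other formulas;
  -- thus `r` can be carried above `□R`.
  cut□ : (A : Formula Atom) (Θ : Multiset Atom) → map □_ Θ ⊢ [ A ] → Γ₂ ⊢ Δ₂ →
         map □_ Θ ⊆ Γ → Γ₂ ⊆ □ A ∷ Γ → Δ₂ ⊆ Δ → Γ ⊢ Δ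
  cut□ A Θ r (ax i j) γ₀ γ₂ δ₂ with γ₂ i
  ... | there i′ = ax i′ (δ₂ j)
  cut□ A Θ r (⊥L i) γ₀ γ₂ δ₂ with γ₂ i
  ... | there i′ = ⊥L i′
  cut□ A Θ r (⇒L i d e) γ₀ γ₂ δ₂ with γ₂ i
  ... | there i′ = ⇒L i′
    (cut□ A Θ r d γ₀ γ₂ (∷⁺ʳ _ δ₂))
    (cut□ A Θ r e (there ∘ γ₀) (∷-under γ₂) δ₂)
  cut□ A Θ r (⇒R i d) γ₀ γ₂ δ₂ =
    ⇒R (δ₂ i) (cut□ A Θ r d (there ∘ γ₀) (∷-under γ₂) (∷⁺ʳ _ δ₂))
  cut□ A Θ r (□L i d) γ₀ γ₂ δ₂ with γ₂ i
    | cut□ A Θ r d (there ∘ γ₀) (∷-under γ₂) δ₂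
  ... | here refl | d′ = cut A r d′ γ₀ (∷⁺ʳ _ λ ()) id id
  ... | there i′  | d′ = □L i′ d′
  cut□ A Θ r (□R i d) γ₀ γ₂ δ₂ =
    □R (δ₂ i) (cut□ A Θ r d (map□⊆boxed γ₀) (boxed-mono γ₂) id)

-- From G3s to the cumulative calculus.

∷-↭⇒⊆ : Γ ↭ X ∷ Γ₀ → Γ₀ ⊆ Γ
∷-↭⇒⊆ p = ∈-resp-↭ (↭-sym p) ∘ there

∷-↭⇒∈ : Γ ↭ X ∷ Γ₀ → X ∈ Γ
∷-↭⇒∈ p = ∈-resp-↭ (↭-sym p) (here refl)

fromG3s : G3s⊢ Γ ⊃ Δ → Γ ⊢ Δ
fromG3s (Ax p q)   = ax (∷-↭⇒∈ p) (∷-↭⇒∈ q)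
fromG3s (⊥⊃ p)     = ⊥L (∷-↭⇒∈ p)
fromG3s (⇒⊃ p d e) = ⇒L (∷-↭⇒∈ p)
  (weaken (∷-↭⇒⊆ p) id (fromG3s d))
  (weaken (∷⁺ʳ _ (∷-↭⇒⊆ p)) id (fromG3s e))
fromG3s (⊃⇒ p d)   = ⇒R (∷-↭⇒∈ p) (weaken id (∷⁺ʳ _ (∷-↭⇒⊆ p)) (fromG3s d))
fromG3s (□⊃ p d)   =
  □L (∷-↭⇒∈ p) (weaken (∷⁺ʳ _ (∈-resp-↭ (↭-sym p))) id (fromG3s d))
fromG3s (⊃□ {Γ′ = Γ′} p q d) = □R (∷-↭⇒∈ q)
  (weaken (map□⊆boxed (∈-resp-↭ (↭-sym p) ∘ ∈-++⁺ʳ Γ′)) id (fromG3s d))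

-- Realisation and the return to G3s.

mutual
  -- A realiser records how `⇒⊃` and `⊃⇒` have decomposed a formula along one branch; `antecedent`
  -- and `consequent` name the premise of `⇒⊃` taken.
  data RealisedL {Atom : Set} (Γ Δ : Multiset Atom) : Formula Atom → Set where
    member     : A ∈ Γ → RealisedL Γ Δ A
    antecedent : RealisedR Γ Δ A → RealisedL Γ Δ (A ⇒ B)
    consequent : RealisedL Γ Δ B → RealisedL Γ Δ (A ⇒ B)

  data RealisedR {Atom : Set} (Γ Δ : Multiset Atom) : Formula Atom → Set where
    member : A ∈ Δ → RealisedR Γ Δ A
    both   : RealisedL Γ Δ A → RealisedR Γ Δ B → RealisedR Γ Δ (A ⇒ B)

record Realises {Atom : Set} (Γ Δ Γ₁ Δ₁ : Multiset Atom) : Set where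
  constructor _,_
  field
    left  : X ∈ Γ₁ → RealisedL Γ Δ X
    right : X ∈ Δ₁ → RealisedR Γ Δ X

open Realises

mutual
  realisedL-trans : Realises Γ₂ Δ₂ Γ₁ Δ₁ → RealisedL Γ₁ Δ₁ A → RealisedL Γ₂ Δ₂ A
  realisedL-trans ρ (member i)     = left ρ i
  realisedL-trans ρ (antecedent x) = antecedent (realisedR-trans ρ x)
  realisedL-trans ρ (consequent x) = consequent (realisedL-trans ρ x)

  realisedR-trans : Realises Γ₂ Δ₂ Γ₁ Δ₁ → RealisedR Γ₁ Δ₁ A → RealisedR Γ₂ Δ₂ A
  realisedR-trans ρ (member i) = right ρ i
  realisedR-trans ρ (both x y) = both (realisedL-trans ρ x) (realisedR-trans ρ y)

realises-refl : Realises Γ Δ Γ Δ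
realises-refl = member , member

realises-trans : Realises Γ₂ Δ₂ Γ₁ Δ₁ → Realises Γ₁ Δ₁ Γ₀ Δ₀ → Realises Γ₂ Δ₂ Γ₀ Δ₀
realises-trans ρ σ = (λ i → realisedL-trans ρ (left σ i)) , (λ i → realisedR-trans ρ (right σ i))

extend : (Q : Formula Atom → Set) →
         Q X → (∀ {Y} → Y ∈ Γ → Q Y) → ∀ {Y} → Y ∈ X ∷ Γ → Q Y
extend Q q f (here refl) = q
extend Q q f (there i)   = f i

extendL : RealisedL Γ Δ X → Realises Γ Δ Γ₁ Δ₁ → Realises Γ Δ (X ∷ Γ₁) Δ₁
extendL x ρ = extend (RealisedL _ _) x (left ρ) , right ρ

extendR : RealisedR Γ Δ X → Realises Γ Δ Γ₁ Δ₁ → Realises Γ Δ Γ₁ (X ∷ Δ₁)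
extendR x ρ = left ρ , extend (RealisedR _ _) x (right ρ)

⇒⊃-premiseˡ : Γ ↭ A ⇒ B ∷ Γ₀ → Realises Γ₀ (A ∷ Δ) Γ Δ
⇒⊃-premiseˡ p =
  (λ i → extend (RealisedL _ _) (antecedent (member (here refl))) member (∈-resp-↭ p i)) ,
  (λ i → member (there i))

⇒⊃-premiseʳ : Γ ↭ A ⇒ B ∷ Γ₀ → Realises (B ∷ Γ₀) Δ Γ Δ
⇒⊃-premiseʳ p =
  (λ i → extend (RealisedL _ _) (consequent (member (here refl))) (λ j → member (there j)) (∈-resp-↭ p i)) ,
  member

⊃⇒-premise : Δ ↭ A ⇒ B ∷ Δ₀ → Realises (A ∷ Γ) (B ∷ Δ₀) Γ Δ
⊃⇒-premise p =
  (λ i → member (there i)) ,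
  (λ i → extend (RealisedR _ _) (both (member (here refl)) (member (here refl)))
                (λ j → member (there j)) (∈-resp-↭ p i))

□⊃-premise : Γ ↭ □ A ∷ Γ₀ → Realises (A ∷ □ A ∷ Γ₀) Δ Γ Δ
□⊃-premise p = (λ i → member (there (∈-resp-↭ p i))) , member

-- A box is realised only by membership, so its realiser does not depend on the formulas that `⊃□`
-- discards.
⊃□-premise : Realises Γ Δ Γ₁ Δ₁ → Realises (boxed Γ) [ A ] (boxed Γ₁) [ A ]
⊃□-premise {Γ = Γ} {Γ₁ = Γ₁} {A = A} ρ = boxed-left , member
  where
  boxed-left : X ∈ boxed Γ₁ → RealisedL (boxed Γ) [ A ] X
  boxed-left i with ∈-map⁻ □_ i
  ... | _ , _ , refl with left ρ (boxed⊆ i)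
  ... | member j = member (∈-boxed⁺ j)

∈⇒↭∷ : X ∈ Γ → ∃[ Γ₀ ] Γ ↭ X ∷ Γ₀
∈⇒↭∷ i with ∈-∃++ i
... | Γ₁ , Γ₂ , refl = Γ₁ ++ Γ₂ , shift _ Γ₁ Γ₂

-- When the principal implication is already decomposed, no G3s rule is applied: its realiser
-- selects a premise and realises the new formulas there.
toG3s : Γ₁ ⊢ Δ₁ → Realises Γ Δ Γ₁ Δ₁ → G3s⊢ Γ ⊃ Δ
toG3s (ax i j) ρ with left ρ i | right ρ j
... | member i′ | member j′ with ∈⇒↭∷ i′ | ∈⇒↭∷ j′
... | _ , p | _ , q = Ax p q
toG3s (⊥L i) ρ with left ρ i
... | member i′ with ∈⇒↭∷ i′
... | _ , p = ⊥⊃ p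
toG3s (⇒L i d e) ρ with left ρ i
... | antecedent x = toG3s d (extendR x ρ)
... | consequent x = toG3s e (extendL x ρ)
... | member i′ with ∈⇒↭∷ i′
... | _ , p = ⇒⊃ p
  (toG3s d (extendR (member (here refl)) (realises-trans (⇒⊃-premiseˡ p) ρ)))
  (toG3s e (extendL (member (here refl)) (realises-trans (⇒⊃-premiseʳ p) ρ)))
toG3s (⇒R i d) ρ with right ρ i
... | both x y = toG3s d (extendL x (extendR y ρ))
... | member i′ with ∈⇒↭∷ i′
... | _ , p = ⊃⇒ p
  (toG3s d (extendL (member (here refl)) (extendR (member (here refl))
    (realises-trans (⊃⇒-premise p) ρ))))
toG3s (□L i d) ρ with left ρ i
... | member i′ with ∈⇒↭∷ i′
... | _ , p = □⊃ p
  (toG3s d (extendL (member (here refl)) (realises-trans (□⊃-premise p) ρ)))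
toG3s {Γ = Γ} (□R i d) ρ with right ρ i
... | member i′ with ∈⇒↭∷ i′
... | _ , q = ⊃□ (boxed-split Γ) q (toG3s d (⊃□-premise ρ))

□-distrib-⇒ : □ (A ⇒ B) ∷ □ A ∷ Γ ⊢ □ B ∷ Δ
□-distrib-⇒ {A = A} {B = B} = □R (here refl)
  (□L (here refl) (□L (there (there (here refl)))
    (⇒L (there (here refl)) (identity A (here refl) (here refl))
                            (identity B (here refl) (here refl)))))

mainTheorem3 : (Atom : Set) (Γ Δ : Multiset Atom) (A B : Formula Atom) →
    G3s⊢ Γ ⊃ □ A ∷ □ B ∷ Δ →
    G3s⊢ Γ ⊃ □ (A ⇒ B) ∷ □ B ∷ Δ →
    G3s⊢ Γ ⊃ □ B ∷ Δ
mainTheorem3 Atom Γ Δ A B d e = toG3s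
  (cut (□ A) (fromG3s d)
    -- This inner cut derives `□ A ∷ Γ ⊢ □ B ∷ Δ`; `there` adds `□ A` to the antecedent of `e`.
    (cut (□ (A ⇒ B)) (fromG3s e) □-distrib-⇒ there id id id)
    id id id id)
  realises-refl
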